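{- For any $\varepsilon>0$ and any monotone summable property $\mathcal{P}$ of a class $\mathcal{G}$ of bounded asymptotic dimension, there are constants $r\ge 0$ and $K\ge 0$ such that $\mathcal{P}$ has an $r$-round $\varepsilon$-approximate proof labelling scheme of complexity at most $K$.
   Context: All graphs are finite and simple. Asymptotic dimension. For a graph $G$ and an integer $r\ge1$, $G^r$ is the graph obtained from $G$ by adding edges between any pair of vertices at distance at most $r$ in $G$. The weak diameter of a set $S\subseteq V(G)$ is the maximum distance in $G$ between two vertices of $S$. A monochromatic component of a vertex-colored graph is a connected component of a subgraph induced by one of the color classes. For an integer $d\ge0$, a class $\mathcal{G}$ has asymptotic dimension at most $d$ if there is a function $D:\mathbb{N}\to\mathbb{N}$ such that for every integer $r\ge1$, every $G\in\mathcal{G}$ has a (not necessarily proper) $(d+1)$-coloring of its vertex set such that every monochromatic component of $G^r$ has weak diameter at most $D(r)$ in $G$. The class has bounded asymptotic dimension if it has asymptotic dimension at most $d$ for some integer $d\ge 0$. A property $\mathcal{P}$ of a class $\mathcal{G}$ is an isomorphism-closed class of graphs $\mathcal{P}\subseteq\mathcal{G}$; it is monotone if it is closed under taking (not necessarily induced) subgraphs, and summable if the disjoint union of any two graphs in $\mathcal{P}$ is also in $\mathcal{P}$. A graph $G$ is $\varepsilon$-far from $\mathcal{P}$ if $G\notin\mathcal{P}$ and one needs to modify at least $\varepsilon|E(G)|$ adjacencies of $G$ (replacing edges by non-edges and vice versa, on the vertex set of $G$) in order to obtain a graph in $\mathcal{P}$ (this graph need not be connected). Local certification. The instance graphs $G$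 to be certified are connected, and the vertices of an $n$-vertex instance are assigned distinct but otherwise arbitrary identifiers from $\{1,\dots,\mathrm{poly}(n)\}$ (for some fixed polynomial); instances are considered as labelled by these identifiers, and so are their subgraphs. A proof for $G$ is a function $P:V(G)\to\{0,1\}^*$ (it may depend on the identifiers); its size is the maximum length of a certificate $P(v)$, $v\in V(G)$. A verifier $\mathcal{A}$ is a function taking a (labelled) graph $G$, a proof $P$ for $G$ and a vertex $v\in V(G)$ and returning an element of $\{0,1\}$. Let $B_r(v)$ be the set of vertices at distance at most $r$ from $v$ in $G$, let $G[v,r]$ be the subgraph of $G$ induced by $B_r(v)$, and let $P[v,r]$ be the restriction of $P$ to $B_r(v)$. The verifier $\mathcal{A}$ is local with local horizon at most $r$ if $\mathcal{A}(G,P,v)=\mathcal{A}(G[v,r],P[v,r],v)$ for all $G,P,v$. An $r$-round $\varepsilon$-approximate proof labelling scheme for $\mathcal{P}$ is a pair consisting of a prover, which maps each instance $G\in\mathcal{P}$ to a proof $P_G$ for $G$, and a local verifier $\mathcal{A}$ with local horizon at most $r$, such that: (completeness) if $G\in\mathcal{P}$, then $\mathcal{A}(G,P_G,v)=1$ for every $v\in V(G)$; (soundness) if $G$ is $\varepsilon$-far from $\mathcal{P}$, then for every proof $P'$ for $G$ there is a vertex $v\in V(G)$ with $\mathcal{A}(G,P',v)=0$. The complexity of the scheme is the maximum size of the proof $P_G$ over $n$-vertex instances $G\in\mathcal{P}$ (as a function of $n$); complexity at most $K$ means this is at most $K$ for all $n$. -}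

module Defs where

open import Data.Bool using (Bool; true; false; T; T?; _xor_)
open import Data.Fin using (Fin; zero; suc; splitAt; _<?_)
open import Data.Fin.Properties using (_≟_; any?)
open import Data.Integer using (+_)
open import Data.List using (List; length; lookup; filter; filterᵇ; map; foldr; allFin; cartesianProduct)
open import Data.List.Extrema.Nat using (max)
open import Data.List.Membership.Propositional using (_∈_)
open import Data.List.Membership.Propositional.Properties using (∈-filter⁺; ∈-allFin; ∈-lookup)
open import Data.List.Relation.Unary.All as All using ()
open import Data.List.Relation.Unary.AllPairs using (_∷_)
open import Data.List.Relation.Unary.Any as Any using ()
open import Data.List.Relation.Unary.Unique.Propositional using (Unique)
import Data.List.Relation.Unary.Unique.Propositional.Properties as Unique
open import Data.Nat using (ℕ; zero; suc; _+_; _*_; _≤_; _<_)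
open import Data.Product using (Σ; ∃; ∃-syntax; _×_; _,_)
open import Data.Rational as ℚ using (ℚ; 0ℚ)
open import Data.Sum using (_⊎_; inj₁; inj₂)
open import Function using (_∘_; _⇔_; mk⇔; _↔_; Inverse; Injective)
open import Level using (0ℓ)
open import Relation.Binary using (Decidable)
open import Relation.Binary.Construct.Closure.ReflexiveTransitive using (Star)
open import Relation.Binary.PropositionalEquality using (_≡_; refl; sym; cong; subst)
open import Relation.Nullary using (yes; no; ¬_; does; contradiction)
open import Relation.Nullary.Decidable using (map′; _×-dec_; ¬?; dec-false; does-⇔)
open import Relation.Unary using (Pred)

------------------------------------------------------------------------
-- Real numbers, as two-sided Dedekind cuts

record ℝ : Set₁ where
  field
    lower upper     : ℚ → Set
    lower-inhabited : ∃ lower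
    upper-inhabited : ∃ upper
    lower-rounded   : ∀ p → lower p ⇔ (∃[ q ] p ℚ.< q × lower q)
    upper-rounded   : ∀ q → upper q ⇔ (∃[ p ] p ℚ.< q × upper p)
    disjoint        : ∀ q → ¬ (lower q × upper q)
    located         : ∀ p q → p ℚ.< q → lower p ⊎ upper q

Positive : ℝ → Set
Positive ε = ℝ.lower ε 0ℚ

-- The inequality  ε · m ≤ k,  tested on all rationals below ε.
_·_≤ℝ_ : ℝ → ℕ → ℕ → Set
ε · m ≤ℝ k = ∀ q → ℝ.lower ε q → q ℚ.* (+ m ℚ./ 1) ℚ.≤ (+ k ℚ./ 1)

------------------------------------------------------------------------
-- Finite simple graphs

record Graph (n : ℕ) : Set where
  field
    adj     : Fin n → Fin n → Bool
    adj-sym : ∀ u v → adj u v ≡ adj v u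
    no-loop : ∀ v → adj v v ≡ false

open Graph public

GraphClass : Set₁
GraphClass = ∀ {n} → Graph n → Set

_⊢_~_ : ∀ {n} → Graph n → Fin n → Fin n → Set
G ⊢ u ~ v = T (adj G u v)

Joined : ∀ {n} → Graph n → Fin n → Fin n → Set
Joined G = Star (G ⊢_~_)

-- The graph without vertices is not connected.
Connected : ∀ {n} → Graph n → Set
Connected {n} G = 0 < n × (∀ u v → Joined G u v)

record _≅_ {m n} (G : Graph m) (H : Graph n) : Set where
  field
    bijection : Fin m ↔ Fin n
  open Inverse bijection public using (to; from)
  field
    to-adj : ∀ u v → adj H (to u) (to v) ≡ adj G u v

-- H is, up to renaming of vertices, a (not necessarily induced) subgraph of G.
record _⊑_ {m n} (H : Graph m) (G : Graph n) : Set where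
  field
    embed     : Fin m → Fin n
    injective : Injective _≡_ _≡_ embed
    edges     : ∀ u v → H ⊢ u ~ v → G ⊢ embed u ~ embed v

_⊎ᴳ_ : ∀ {m n} → Graph m → Graph n → Graph (m + n)
_⊎ᴳ_ {m} {n} G H = record
  { adj     = λ u v → adj⊎ (splitAt m u) (splitAt m v)
  ; adj-sym = λ u v → adj⊎-sym (splitAt m u) (splitAt m v)
  ; no-loop = λ v → no-loop⊎ (splitAt m v)
  }
  where
  adj⊎ : Fin m ⊎ Fin n → Fin m ⊎ Fin n → Bool
  adj⊎ (inj₁ u) (inj₁ v) = adj G u v
  adj⊎ (inj₂ u) (inj₂ v) = adj H u v
  adj⊎ (inj₁ _) (inj₂ _) = false
  adj⊎ (inj₂ _) (inj₁ _) = false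

  adj⊎-sym : ∀ u v → adj⊎ u v ≡ adj⊎ v u
  adj⊎-sym (inj₁ u) (inj₁ v) = adj-sym G u v
  adj⊎-sym (inj₂ u) (inj₂ v) = adj-sym H u v
  adj⊎-sym (inj₁ _) (inj₂ _) = refl
  adj⊎-sym (inj₂ _) (inj₁ _) = refl

  no-loop⊎ : ∀ v → adj⊎ v v ≡ false
  no-loop⊎ (inj₁ v) = no-loop G v
  no-loop⊎ (inj₂ v) = no-loop H v

-- Induced subgraph on the vertices listed in xs (intended duplicate-free);
-- its i-th vertex is  lookup xs i.
_[_] : ∀ {n} → Graph n → (xs : List (Fin n)) → Graph (length xs)
G [ xs ] = record
  { adj     = λ i j → adj G (lookup xs i) (lookup xs j)
  ; adj-sym = λ i j → adj-sym G (lookup xs i) (lookup xs j)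
  ; no-loop = λ i → no-loop G (lookup xs i)
  }

-- The number of unordered pairs of distinct vertices satisfying R.
#pairs : ∀ {n} → (Fin n → Fin n → Bool) → ℕ
#pairs {n} R = length (filterᵇ (λ (u , v) → R u v)
                        (filter (λ (u , v) → u <? v)
                          (cartesianProduct (allFin n) (allFin n))))

∣E_∣ : ∀ {n} → Graph n → ℕ
∣E G ∣ = #pairs (adj G)

#modified : ∀ {n} → Graph n → Graph n → ℕ
#modified G H = #pairs (λ u v → adj G u v xor adj H u v)

------------------------------------------------------------------------
-- Distance, balls and powers

-- dist≤ G k u v : the distance between u and v in G is at most k.
data dist≤ {n} (G : Graph n) : ℕ → Fin n → Fin n → Set where
  here : ∀ {k u} → dist≤ G k u u
  step : ∀ {k u v w} → G ⊢ u ~ v → dist≤ G k v w → dist≤ G (suc k) u w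

dist≤? : ∀ {n} (G : Graph n) k → Decidable (dist≤ G k)
dist≤? G k u w with u ≟ w
dist≤? G k       u w | yes refl = yes here
dist≤? G zero    u w | no u≢w = no λ where here → u≢w refl
dist≤? G (suc k) u w | no u≢w =
  map′ (λ (_ , e , p) → step e p)
       (λ where here       → contradiction refl u≢w
                (step e p) → _ , e , p)
       (any? λ v → T? (adj G u v) ×-dec dist≤? G k v w)

dist≤-snoc : ∀ {n} (G : Graph n) {k u v w} → dist≤ G k u v → G ⊢ v ~ w → dist≤ G (suc k) u w
dist≤-snoc G here       f = step f here
dist≤-snoc G (step e p) f = step e (dist≤-snoc G p f)

dist≤-sym : ∀ {n} (G : Graph n) {k u v} → dist≤ G k u v → dist≤ G k v u
dist≤-sym G here = here
dist≤-sym G (step {u = u} {v = v} e p) =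
  dist≤-snoc G (dist≤-sym G p) (subst T (adj-sym G u v) e)

power : ∀ {n} → Graph n → ℕ → Graph n
power G r = record
  { adj     = λ u v → does (near? u v)
  ; adj-sym = λ u v → does-⇔ (mk⇔ near-sym near-sym) (near? u v) (near? v u)
  ; no-loop = λ v → dec-false (near? v v) λ (v≢v , _) → v≢v refl
  }
  where
  near? = λ u v → ¬? (u ≟ v) ×-dec dist≤? G r u v

  near-sym : ∀ {u v} → ¬ (u ≡ v) × dist≤ G r u v → ¬ (v ≡ u) × dist≤ G r v u
  near-sym (u≢v , p) = u≢v ∘ sym , dist≤-sym G p

ball : ∀ {n} → Graph n → Fin n → ℕ → List (Fin n)
ball {n} G v r = filter (dist≤? G r v) (allFin n)

centre∈ball : ∀ {n} (G : Graph n) v r → v ∈ ball G v r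
centre∈ball G v r = ∈-filter⁺ (dist≤? G r v) (∈-allFin v) here

ball-unique : ∀ {n} (G : Graph n) v r → Unique (ball G v r)
ball-unique {n} G v r = Unique.filter⁺ (dist≤? G r v) (Unique.allFin⁺ n)

------------------------------------------------------------------------
-- Asymptotic dimension

WeakDiameter≤ : ∀ {n} → Graph n → ℕ → Pred (Fin n) 0ℓ → Set
WeakDiameter≤ G k S = ∀ {u v} → S u → S v → dist≤ G k u v

colourClass : ∀ {n k} → (Fin n → Fin k) → Fin k → List (Fin n)
colourClass {n} c i = filter (λ v → c v ≟ i) (allFin n)

-- The component of x in the subgraph of H induced by colour i, as a set of
-- vertices of H.
MonochromaticComponent : ∀ {n k} (H : Graph n) (c : Fin n → Fin k) (i : Fin k) →
                         Fin (length (colourClass c i)) → Pred (Fin n) 0ℓ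
MonochromaticComponent H c i x v =
  ∃[ y ] lookup (colourClass c i) y ≡ v × Joined (H [ colourClass c i ]) x y

AsymptoticDimension≤ : GraphClass → ℕ → Set
AsymptoticDimension≤ 𝒢 d =
  Σ (ℕ → ℕ) λ D → ∀ r → 1 ≤ r → ∀ {n} (G : Graph n) → 𝒢 G →
  Σ (Fin n → Fin (suc d)) λ c →
  ∀ i x → WeakDiameter≤ G (D r) (MonochromaticComponent (power G r) c i x)

BoundedAsymptoticDimension : GraphClass → Set
BoundedAsymptoticDimension 𝒢 = ∃[ d ] AsymptoticDimension≤ 𝒢 d

------------------------------------------------------------------------
-- Properties

record IsPropertyOf (𝒢 𝒫 : GraphClass) : Set where
  field
    included          : ∀ {n} (G : Graph n) → 𝒫 G → 𝒢 G
    isomorphismClosed : ∀ {m n} (G : Graph m) (H : Graph n) → G ≅ H → 𝒫 G → 𝒫 H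

Monotone : GraphClass → Set
Monotone 𝒫 = ∀ {m n} (H : Graph m) (G : Graph n) → H ⊑ G → 𝒫 G → 𝒫 H

Summable : GraphClass → Set
Summable 𝒫 = ∀ {m n} (G : Graph m) (H : Graph n) → 𝒫 G → 𝒫 H → 𝒫 (G ⊎ᴳ H)

Far : ℝ → GraphClass → ∀ {n} → Graph n → Set
Far ε 𝒫 {n} G = ¬ 𝒫 G × (∀ (H : Graph n) → 𝒫 H → ε · ∣E G ∣ ≤ℝ #modified G H)

------------------------------------------------------------------------
-- Labelled graphs and instances

record LabelledGraph : Set where
  field
    {order}      : ℕ
    graph        : Graph order
    ident        : Fin order → ℕ
    ident-unique : Injective _≡_ _≡_ ident

open LabelledGraph public

-- Coefficients, constant term first.
Polynomial : Set
Polynomial = List ℕ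

eval : Polynomial → ℕ → ℕ
eval p n = foldr (λ a b → a + n * b) 0 p

record Instance (p : Polynomial) : Set where
  field
    labelled    : LabelledGraph
    connected   : Connected (graph labelled)
    ident-range : ∀ v → 1 ≤ ident labelled v × ident labelled v ≤ eval p (order labelled)
  open LabelledGraph labelled public
    using () renaming (order to size; graph to underlying)

open Instance public

lookup-injective : ∀ {A : Set} {xs : List A} → Unique xs → Injective _≡_ _≡_ (lookup xs)
lookup-injective (_  ∷ _)  {zero}  {zero}  _  = refl
lookup-injective (x∉ ∷ _)  {zero}  {suc j} eq = contradiction eq (All.lookup x∉ (∈-lookup j))
lookup-injective (x∉ ∷ _)  {suc i} {zero}  eq = contradiction (sym eq) (All.lookup x∉ (∈-lookup i))
lookup-injective (_  ∷ xs) {suc i} {suc j} eq = cong suc (lookup-injective xs eq)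

view : (L : LabelledGraph) → Fin (order L) → ℕ → LabelledGraph
view L v r = record
  { graph        = graph L [ ball (graph L) v r ]
  ; ident        = ident L ∘ lookup (ball (graph L) v r)
  ; ident-unique = lookup-injective (ball-unique (graph L) v r) ∘ ident-unique L
  }

centre : ∀ (L : LabelledGraph) v r → Fin (order (view L v r))
centre L v r = Any.index (centre∈ball (graph L) v r)

------------------------------------------------------------------------
-- Proof labelling schemes

Proof : ℕ → Set
Proof n = Fin n → List Bool

proofSize : ∀ {n} → Proof n → ℕ
proofSize {n} P = max 0 (map (length ∘ P) (allFin n))

restrict : ∀ (L : LabelledGraph) → Proof (order L) → ∀ v r → Proof (order (view L v r))
restrict L P v r = P ∘ lookup (ball (graph L) v r)

-- A labelled graph is determined by its identifiers and the adjacencies between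
-- them.  The enumeration of the vertices by Fin is not part of the data
-- available to a verifier, whence the invariance requirement.
record Verifier : Set where
  field
    decide    : (L : LabelledGraph) → Proof (order L) → Fin (order L) → Bool
    invariant : ∀ L M (σ : graph L ≅ graph M) → (∀ v → ident M (_≅_.to σ v) ≡ ident L v) →
                ∀ P Q → (∀ v → Q (_≅_.to σ v) ≡ P v) →
                ∀ v → decide L P v ≡ decide M Q (_≅_.to σ v)

open Verifier public

LocalHorizon≤ : Verifier → ℕ → Set
LocalHorizon≤ 𝒜 r = ∀ L P v →
  decide 𝒜 L P v ≡ decide 𝒜 (view L v r) (restrict L P v r) (centre L v r)

record ApproximateProofLabellingScheme
         (p : Polynomial) (r : ℕ) (ε : ℝ) (𝒫 : GraphClass) : Set where
  field
    prover       : (G : Instance p) → 𝒫 (underlying G) → Proof (size G)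
    verifier     : Verifier
    local        : LocalHorizon≤ verifier r
    completeness : ∀ (G : Instance p) (G∈𝒫 : 𝒫 (underlying G)) v →
                   decide verifier (labelled G) (prover G G∈𝒫) v ≡ true
    soundness    : ∀ (G : Instance p) → Far ε 𝒫 (underlying G) → ∀ P′ →
                   ∃[ v ] decide verifier (labelled G) P′ v ≡ false

open ApproximateProofLabellingScheme public

Complexity≤ : ∀ {p r ε} {𝒫 : GraphClass} → ApproximateProofLabellingScheme p r ε 𝒫 → ℕ → Set
Complexity≤ {p} {𝒫 = 𝒫} S K =
  ∀ (G : Instance p) (G∈𝒫 : 𝒫 (underlying G)) → proofSize (prover S G G∈𝒫) ≤ K

{-# OPTIONS --safe #-}

-- The certificate of a vertex is its colour, for the colouring c that asymptotic
-- dimension provides at scale r.  A vertex v accepts if its monochromatic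
-- component of G^r stays within distance D of v, and all graphs that embed near
-- v are in 𝒫.  No edge counting is verified: it only occurs in the soundness
-- proof.  If every vertex accepts, then for each colour i consider the balls
-- B_j around the set of vertices of colour i.  The edge boundaries of the B_j,
-- j < m, are disjoint, so one of them, say for j = j_i, has at most |E| / m
-- edges.  Deleting these boundaries for all i leaves components that are close
-- to a single monochromatic component of G^r, because r > 2m.  Hence they are
-- seen to be in 𝒫 by their vertices, and by summability what remains of G is
-- in 𝒫 as well.

module Submission where

open import Axiom.ExcludedMiddle using (ExcludedMiddle)
open import Data.Bool using (Bool; true; false; T; T?; not; _∧_; _xor_)
import Data.Bool as Bool
open import Data.Bool.Properties using (T-∧)
open import Data.Fin as Fin using (Fin; zero; suc; toℕ; fromℕ<; splitAt; _↑ˡ_; _↑ʳ_; _<?_)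
open import Data.Fin.Properties
  using (_≟_; any?; all?; ¬∀⟶∃¬; splitAt-↑ˡ; splitAt-↑ʳ; <-cmp; toℕ≤pred[n])
open import Data.Integer using (+_; -[1+_]; +<+; drop‿+≤+)
import Data.Integer as ℤ
import Data.Integer.Properties as ℤ
open import Data.List using (List; []; _∷_; length; lookup; filter; filterᵇ; map; replicate; allFin;
                              cartesianProduct)
open import Data.List.Extrema.Nat using (max≤v⁺)
open import Data.List.Membership.Propositional using (_∈_; lose)
open import Data.List.Membership.Propositional.Properties
  using (∈-filter⁺; ∈-filter⁻; ∈-allFin; ∈-lookup; ∈-cartesianProduct⁺)
open import Data.List.Properties using (filter-none; length-replicate)
open import Data.List.Relation.Unary.All as All using ()
import Data.List.Relation.Unary.All.Properties as All
open import Data.List.Relation.Unary.Any as Any using (Any)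
open import Data.List.Relation.Unary.Any.Properties using (lookup-index)
open import Data.List.Relation.Unary.Unique.Propositional using (Unique)
import Data.List.Relation.Unary.Unique.Propositional.Properties as Unique
open import Data.Nat using (ℕ; zero; suc; _+_; _*_; _≤_; _<_; _≤?_; z≤n; s≤s; NonZero)
open import Data.Nat.Properties
  using (≤-refl; ≤-reflexive; ≤-trans; n≤1+n; m≤n⇒m≤1+n; m≤m+n; m≤n+m; 1+n≰n; ≰⇒>; <⇒≤; n≤0⇒n≡0;
         +-suc; +-monoʳ-≤; +-mono-≤; +-cancelʳ-≤; *-comm; *-assoc; *-zeroʳ; *-distribˡ-+;
         *-monoʳ-≤; *-cancelˡ-≤; m*n≢0; module ≤-Reasoning)
open import Data.Product using (Σ; ∃-syntax; _×_; _,_; proj₁; proj₂; map₂)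
open import Data.Rational as ℚ using (ℚ; 0ℚ; mkℚ; toℚᵘ)
import Data.Rational.Properties as ℚ
open import Data.Rational.Unnormalised as ℚᵘ using (mkℚᵘ)
import Data.Rational.Unnormalised.Properties as ℚᵘ
open import Data.Sum using (_⊎_; inj₁; inj₂; [_,_]′)
open import Function using (_∘_; id; _⇔_; mk⇔; Equivalence; Injective; Inverse; Injection)
open import Function.Properties.Inverse using (Inverse⇒Injection)
open import Level using (0ℓ)
open import Relation.Binary using (tri<; tri≈; tri>)
open import Relation.Binary.Construct.Closure.ReflexiveTransitive using (_◅_; _◅◅_) renaming (ε to done)
open import Relation.Binary.PropositionalEquality
  using (_≡_; _≢_; refl; sym; trans; cong; cong₂; subst; subst₂)
open import Relation.Nullary using (¬_; Dec; yes; no; does; contradiction)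
open import Relation.Nullary.Decidable
  using (⌊_⌋; toWitness; fromWitness; does-⇔; dec-true; dec-false; _×-dec_; ¬?)
open import Relation.Unary using (Pred; Decidable)

open import Defs

private variable
  A : Set
  n : ℕ

T-not : ∀ {b} → T (not b) → ¬ T b
T-not {false} _ ()

T-does : (a? : Dec A) → T (does a?) → A
T-does (yes a) _ = a

-- Counting

count : (A → Bool) → List A → ℕ
count f xs = length (filterᵇ f xs)

module _ {f g h : A → Bool} where

  count-disjoint : (∀ a → T (f a) → T (h a)) → (∀ a → T (g a) → T (h a)) →
                   (∀ a → T (f a) → ¬ T (g a)) →
                   ∀ xs → count f xs + count g xs ≤ count h xs
  count-disjoint f⇒h g⇒h f⇒¬g [] = z≤n
  count-disjoint f⇒h g⇒h f⇒¬g (a ∷ xs)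
    with ih ← count-disjoint f⇒h g⇒h f⇒¬g xs | f a | g a | h a | f⇒h a | g⇒h a | f⇒¬g a
  ... | true  | true  | _     | _  | _  | ¬p = contradiction _ (¬p _)
  ... | true  | false | false | p  | _  | _  = contradiction (p _) λ ()
  ... | false | true  | false | _  | p  | _  = contradiction (p _) λ ()
  ... | true  | false | true  | _  | _  | _  = s≤s ih
  ... | false | true  | true  | _  | _  | _  = ≤-trans (≤-reflexive (+-suc _ _)) (s≤s ih)
  ... | false | false | true  | _  | _  | _  = m≤n⇒m≤1+n ih
  ... | false | false | false | _  | _  | _  = ih

  count-cover : (∀ a → T (h a) → T (f a) ⊎ T (g a)) →
                ∀ xs → count h xs ≤ count f xs + count g xs
  count-cover h⇒f⊎g [] = z≤n
  count-cover h⇒f⊎g (a ∷ xs)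
    with ih ← count-cover h⇒f⊎g xs | f a | g a | h a | h⇒f⊎g a
  ... | false | false | true  | p = contradiction (p _) λ { (inj₁ ()) ; (inj₂ ()) }
  ... | true  | true  | true  | _ = s≤s (≤-trans ih (+-monoʳ-≤ (count f xs) (n≤1+n _)))
  ... | true  | false | true  | _ = s≤s ih
  ... | false | true  | true  | _ = ≤-trans (s≤s ih) (≤-reflexive (sym (+-suc _ _)))
  ... | true  | true  | false | _ = m≤n⇒m≤1+n (≤-trans ih (+-monoʳ-≤ (count f xs) (n≤1+n _)))
  ... | true  | false | false | _ = m≤n⇒m≤1+n ih
  ... | false | true  | false | _ = ≤-trans ih (+-monoʳ-≤ (count f xs) (n≤1+n _))
  ... | false | false | false | _ = ih

count-none : {f : A → Bool} → (∀ a → ¬ T (f a)) → ∀ xs → count f xs ≡ 0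
count-none {f = f} ¬f xs = cong length (filter-none (T? ∘ f) (All.universal ¬f xs))

count-zero : {f : A → Bool} {a : A} {xs : List A} → count f xs ≡ 0 → a ∈ xs → ¬ T (f a)
count-zero {f = f} {xs = xs} eq a∈xs fa with filterᵇ f xs | ∈-filter⁺ (T? ∘ f) a∈xs fa | eq
... | [] | () | _

-- Induction on `k`: what `f zero` covers is taken out of `h`, and the functions `f (suc i)` cover
-- the rest. Keeping the factor `m` on the left avoids division.
count-union : ∀ {k} (f : Fin k → A → Bool) {h : A → Bool} (xs : List A) {m e : ℕ} →
              (∀ i → m * count (f i) xs ≤ e) → (∀ a → T (h a) → ∃[ i ] T (f i a)) →
              m * count h xs ≤ k * e
count-union {k = zero} f {h} xs {m} small h⇒f
  rewrite count-none {f = h} (λ a ha → contradiction (proj₁ (h⇒f a ha)) λ ()) xs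
        | *-zeroʳ m = z≤n
count-union {A = A} {k = suc k} f {h} xs {m} {e} small h⇒f = begin
  m * count h xs                              ≤⟨ *-monoʳ-≤ m (count-cover {f = f zero} {rest} {h} cover xs) ⟩
  m * (count (f zero) xs + count rest xs)     ≡⟨ *-distribˡ-+ m (count (f zero) xs) _ ⟩
  m * count (f zero) xs + m * count rest xs   ≤⟨ +-mono-≤ (small zero)
                                                   (count-union (f ∘ suc) xs {m} (small ∘ suc) rest⇒f) ⟩
  e + k * e                                   ∎
  where
  open ≤-Reasoning

  rest : A → Bool
  rest a = h a ∧ not (f zero a)

  cover : ∀ a → T (h a) → T (f zero a) ⊎ T (rest a)
  cover a ha with f zero a | h a
  ... | true  | _    = inj₁ _
  ... | false | true = inj₂ _

  rest⇒f : ∀ a → T (rest a) → ∃[ i ] T (f (suc i) a)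
  rest⇒f a ra with ha , ¬f₀ ← Equivalence.to T-∧ ra | h⇒f a ha
  ... | zero  , f₀ = contradiction f₀ (T-not ¬f₀)
  ... | suc i , fᵢ = i , fᵢ

-- Pigeonhole by telescoping: if `m * boundary j` exceeded `e` for all `j < m`, the increments would
-- add up to `m * suc e ≤ m * inner m`, against `inner m ≤ e`.
small-increment : ∀ m .{{_ : NonZero m}} (inner boundary : ℕ → ℕ) {e} →
                  (∀ j → boundary j + inner j ≤ inner (suc j)) → (∀ j → inner j ≤ e) →
                  ∃[ j ] j < m × m * boundary j ≤ e
small-increment m inner boundary {e} increment bounded with search m
  where
  open ≤-Reasoning

  search : ∀ t → (∃[ j ] j < t × m * boundary j ≤ e) ⊎ t * suc e ≤ m * inner t
  search zero = inj₂ z≤n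
  search (suc t) with search t | m * boundary t ≤? e
  ... | inj₁ (j , j<t , small) | _         = inj₁ (j , m≤n⇒m≤1+n j<t , small)
  ... | inj₂ _                 | yes small = inj₁ (t , ≤-refl , small)
  ... | inj₂ large             | no ¬small = inj₂ (begin
    suc e + t * suc e             ≤⟨ +-mono-≤ (≰⇒> ¬small) large ⟩
    m * boundary t + m * inner t  ≡⟨ *-distribˡ-+ m (boundary t) (inner t) ⟨
    m * (boundary t + inner t)    ≤⟨ *-monoʳ-≤ m (increment t) ⟩
    m * inner (suc t)             ∎)
... | inj₁ found = found
... | inj₂ large = contradiction (*-cancelˡ-≤ m (≤-trans large (*-monoʳ-≤ m (bounded m)))) 1+n≰n

-- Distances

module _ (G : Graph n) where

  dist≤-mono : ∀ {k l u v} → k ≤ l → dist≤ G k u v → dist≤ G l u v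
  dist≤-mono _         here       = here
  dist≤-mono (s≤s k≤l) (step e p) = step e (dist≤-mono k≤l p)

  dist≤-trans : ∀ {k l u v w} → dist≤ G k u v → dist≤ G l v w → dist≤ G (k + l) u w
  dist≤-trans {k} {l} here q = dist≤-mono (m≤n+m l k) q
  dist≤-trans (step e p) q   = step e (dist≤-trans p q)

-- Acceptance and its locality

⊑-trans : ∀ {k m} {K : Graph k} {G : Graph m} {H : Graph n} → K ⊑ G → G ⊑ H → K ⊑ H
⊑-trans K⊑G G⊑H = record
  { embed     = _⊑_.embed G⊑H ∘ _⊑_.embed K⊑G
  ; injective = _⊑_.injective K⊑G ∘ _⊑_.injective G⊑H
  ; edges     = λ u v → _⊑_.edges G⊑H _ _ ∘ _⊑_.edges K⊑G u v
  }

-- The steps of a chain are the edges of G^r between vertices of equal colour.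
data Chain {n k} (G : Graph n) (c : Fin n → Fin k) (r : ℕ) (v : Fin n) : Fin n → Set where
  start  : Chain G c r v v
  extend : ∀ {x y} → Chain G c r v x → c x ≡ c y → dist≤ G r x y → Chain G c r v y

-- `near-∈` ranges over all graphs embeddable near `v` instead of naming the ball, so that it is
-- transported by composing and factoring embeddings. Chains have unbounded length; `chain-near` is
-- what makes the condition local.
record Accept (𝒫 : GraphClass) (D r : ℕ) {n k} (G : Graph n) (c : Fin n → Fin k) (v : Fin n) : Set where
  field
    chain-near : ∀ {u} → Chain G c r v u → dist≤ G D v u
    near-∈     : ∀ {m} (K : Graph m) (K⊑G : K ⊑ G) →
                 (∀ i → dist≤ G (D + r) v (_⊑_.embed K⊑G i)) → 𝒫 K

open Accept

-- Transport of acceptance along an induced embedding that covers a ball.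

module _ (𝒫 : GraphClass) (D r : ℕ) {m n k} {G : Graph m} {H : Graph n}
         {c : Fin m → Fin k} {c′ : Fin n → Fin k} (f : Fin m → Fin n) (v : Fin m)
         (f-injective : Injective _≡_ _≡_ f)
         (f-adj : ∀ u w → adj H (f u) (f w) ≡ adj G u w)
         (f-colour : ∀ u → c′ (f u) ≡ c u)
         (f-onto-ball : ∀ {y} → dist≤ H (D + r) (f v) y → ∃[ x ] f x ≡ y)
         where

  private
    push-edge : ∀ {u w} → G ⊢ u ~ w → H ⊢ f u ~ f w
    push-edge = subst T (sym (f-adj _ _))

    pull-edge : ∀ {u w} → H ⊢ f u ~ f w → G ⊢ u ~ w
    pull-edge = subst T (f-adj _ _)

    push-dist : ∀ {l u w} → dist≤ G l u w → dist≤ H l (f u) (f w)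
    push-dist here       = here
    push-dist (step e p) = step (push-edge e) (push-dist p)

    -- `a` is the distance already walked from `f v`; the budget `a + l ≤ D + r` keeps every vertex
    -- of the walk in the ball, hence in the image of `f`.
    pull-dist : ∀ {l a u y} → a + l ≤ D + r → dist≤ H a (f v) (f u) → dist≤ H l (f u) y →
                ∃[ w ] f w ≡ y × dist≤ G l u w
    pull-dist _ _ here = _ , refl , here
    pull-dist {suc l} {a} a+l≤R p (step e q)
      with a+l<R ← ≤-trans (≤-reflexive (sym (+-suc a l))) a+l≤R
      with f-onto-ball (dist≤-mono H (≤-trans (s≤s (m≤m+n a l)) a+l<R) (dist≤-snoc H p e))
    ... | x , refl with pull-dist a+l<R (dist≤-snoc H p e) q
    ... | w , fw≡y , d = w , fw≡y , step (pull-edge e) d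

    pull-ball : ∀ {l u} → l ≤ D + r → dist≤ H l (f v) (f u) → dist≤ G l v u
    pull-ball l≤R p with pull-dist l≤R (here {k = 0}) p
    ... | w , fw≡fu , d = subst (dist≤ G _ v) (f-injective fw≡fu) d

    push-chain : ∀ {u} → Chain G c r v u → Chain H c′ r (f v) (f u)
    push-chain start = start
    push-chain (extend p eq d) =
      extend (push-chain p) (trans (f-colour _) (trans eq (sym (f-colour _)))) (push-dist d)

    -- A chain of `H` might leave the ball, so it is lifted link by link. The part already lifted is
    -- a chain of `G` and ends within `D` of `v`; the next link, of length at most `r`, stays within
    -- `D + r`. This determines the horizon.
    pull-chain : (∀ {u} → Chain G c r v u → dist≤ G D v u) →
                 ∀ {y} → Chain H c′ r (f v) y → ∃[ u ] f u ≡ y × Chain G c r v u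
    pull-chain near start = v , refl , start
    pull-chain near (extend p eq d) with pull-chain near p
    ... | x , refl , p′ with pull-dist ≤-refl (push-dist (near p′)) d
    ... | w , refl , d′ = w , refl , extend p′ (trans (sym (f-colour x)) (trans eq (f-colour w))) d′

  accept-push : Accept 𝒫 D r G c v → Accept 𝒫 D r H c′ (f v)
  accept-push acc .chain-near p with pull-chain (chain-near acc) p
  ... | u , refl , p′ = push-dist (chain-near acc p′)
  accept-push acc .near-∈ K K⊑H near = near-∈ acc K K⊑G λ i →
    pull-ball ≤-refl (subst (dist≤ H (D + r) (f v)) (sym (preimage-≡ i)) (near i))
    where
    open _⊑_ K⊑H

    preimage : ∀ i → Fin m
    preimage i = proj₁ (f-onto-ball (near i))

    preimage-≡ : ∀ i → f (preimage i) ≡ embed i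
    preimage-≡ i = proj₂ (f-onto-ball (near i))

    K⊑G : K ⊑ G
    K⊑G = record
      { embed     = preimage
      ; injective = λ {i} {j} eq → injective (trans (sym (preimage-≡ i)) (trans (cong f eq) (preimage-≡ j)))
      ; edges     = λ i j e → pull-edge (subst₂ (H ⊢_~_) (sym (preimage-≡ i)) (sym (preimage-≡ j)) (edges i j e))
      }

  accept-pull : Accept 𝒫 D r H c′ (f v) → Accept 𝒫 D r G c v
  accept-pull acc .chain-near p = pull-ball (m≤m+n D r) (chain-near acc (push-chain p))
  accept-pull acc .near-∈ K K⊑G near = near-∈ acc K (⊑-trans K⊑G G⊑H) (push-dist ∘ near)
    where
    G⊑H : G ⊑ H
    G⊑H = record { embed = f ; injective = f-injective ; edges = λ _ _ → push-edge }

  -- With an isomorphism for `f` this gives invariance of the verifier, with the inclusion of a ball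
  -- its locality.
  accept-⇔ : Accept 𝒫 D r G c v ⇔ Accept 𝒫 D r H c′ (f v)
  accept-⇔ = mk⇔ accept-push accept-pull

-- Colours in unary; decode is total, so there are no malformed certificates.

encode : ∀ {d} → Fin (suc d) → List Bool
encode i = replicate (toℕ i) true

decode : ∀ {d} → List Bool → Fin (suc d)
decode         []       = zero
decode {zero}  (_ ∷ _)  = zero
decode {suc d} (_ ∷ bs) = suc (decode bs)

decode-encode : ∀ {d} (i : Fin (suc d)) → decode (encode i) ≡ i
decode-encode         zero    = refl
decode-encode {suc d} (suc i) = cong suc (decode-encode i)

encode-length : ∀ {d} (i : Fin (suc d)) → length (encode i) ≤ d
encode-length i = subst (_≤ _) (sym (length-replicate (toℕ i))) (toℕ≤pred[n] i)

-- The verifier.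

module _ (em : ExcludedMiddle 0ℓ) (𝒫 : GraphClass) (D r d : ℕ) where

  -- Membership in `𝒫` may be undecidable; excluded middle turns acceptance into the bit that a
  -- verifier returns.
  accepts? : ∀ {n} (G : Graph n) (P : Proof n) v → Dec (Accept 𝒫 D r G (decode {d} ∘ P) v)
  accepts? _ _ _ = em

  colourVerifier : Verifier
  colourVerifier .decide L P v = does (accepts? (graph L) P v)
  colourVerifier .invariant L M σ _ P Q eq v = does-⇔
    (accept-⇔ 𝒫 D r to v (Injection.injective (Inverse⇒Injection bijection)) to-adj (cong decode ∘ eq)
      (λ {y} _ → from y , Inverse.strictlyInverseˡ bijection y))
    (accepts? (graph L) P v) (accepts? (graph M) Q (to v))
    where open _≅_ σ

  colourVerifier-local : LocalHorizon≤ colourVerifier (D + r)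
  colourVerifier-local L P v = sym (trans
    -- `accept-⇔` speaks of the image of the centre, which is `v` only up to `centre-≡`; the second
    -- equation moves the bit to `v` itself.
    (does-⇔ (accept-⇔ 𝒫 D r (lookup ballᵥ) (centre L v (D + r))
        (lookup-injective (ball-unique (graph L) v (D + r))) (λ _ _ → refl) (λ _ → refl) onto)
      (accepts? _ _ _) (accepts? (graph L) P (lookup ballᵥ (centre L v (D + r)))))
    (cong (λ u → does (accepts? (graph L) P u)) centre-≡))
    where
    ballᵥ = ball (graph L) v (D + r)

    centre-≡ : lookup ballᵥ (centre L v (D + r)) ≡ v
    centre-≡ = sym (lookup-index (centre∈ball (graph L) v (D + r)))

    onto : ∀ {y} → dist≤ (graph L) (D + r) (lookup ballᵥ (centre L v (D + r))) y →
           ∃[ x ] lookup ballᵥ x ≡ y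
    onto {y} p = Any.index y∈ball , sym (lookup-index y∈ball)
      where
      y∈ball : y ∈ ballᵥ
      y∈ball = ∈-filter⁺ (dist≤? (graph L) (D + r) v) (∈-allFin y)
                 (subst (λ u → dist≤ (graph L) (D + r) u y) centre-≡ p)

-- Completeness

module _ (𝒢 : GraphClass) {d} (bounded : AsymptoticDimension≤ 𝒢 d) {r} (r≥1 : 1 ≤ r)
         {n} (G : Graph n) (G∈𝒢 : 𝒢 G) where

  private
    D = proj₁ bounded r

  colouring : Fin n → Fin (suc d)
  colouring = proj₁ (proj₂ bounded r r≥1 G G∈𝒢)

  -- A chain keeps the colour of `v` and is a walk in `power G r`, so its end lies in the
  -- monochromatic component of `v`, whose weak diameter is at most `D`.
  chain-in-component : ∀ {v u} → Chain G colouring r v u → dist≤ G D v u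
  chain-in-component {v} p =
    proj₂ (proj₂ bounded r r≥1 G G∈𝒢) (colouring v) x (x , x-≡ , done) (proj₂ (component p))
    where
    class = colourClass colouring (colouring v)

    member : ∀ {u} → colouring u ≡ colouring v → ∃[ y ] lookup class y ≡ u
    member eq = Any.index u∈class , sym (lookup-index u∈class)
      where u∈class = ∈-filter⁺ (λ w → colouring w ≟ colouring v) (∈-allFin _) eq

    x   = proj₁ (member refl)
    x-≡ = proj₂ (member refl)

    component : ∀ {u} → Chain G colouring r v u →
                colouring u ≡ colouring v ×
                MonochromaticComponent (power G r) colouring (colouring v) x u
    component start = refl , x , x-≡ , done
    component (extend {y} {z} q eq near) with component q
    ... | y-col , y′ , refl , joined with member (trans (sym eq) y-col) | y ≟ z
    -- A link may repeat its vertex, but `power G r` has no loops; such a link is dropped.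
    ...   | _         | yes refl = y-col , y′ , refl , joined
    ...   | z′ , refl | no y≢z   = trans (sym eq) y-col , z′ , refl , joined ◅◅ (edge ◅ done)
      where
      edge : power G r ⊢ y ~ z
      edge = subst T (sym (dec-true (¬? (y ≟ z) ×-dec dist≤? G r y z) (y≢z , near))) _

-- Summing up components

module _ (em : ExcludedMiddle 0ℓ) (𝒫 : GraphClass) (monotone : Monotone 𝒫) (summable : Summable 𝒫)
         {n} (H : Graph n) where

  -- For monotone `𝒫` this amounts to the subgraph induced by `S` being in `𝒫`, without enumerating
  -- `S`.
  Hereditarily : Pred (Fin n) 0ℓ → Set
  Hereditarily S = ∀ {m} (K : Graph m) (K⊑H : K ⊑ H) → (∀ i → S (_⊑_.embed K⊑H i)) → 𝒫 K

  -- As `S` is closed under adjacency, no edge of `K` joins a vertex in `S` to one outside. So `K`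
  -- embeds into the disjoint union of these two parts, and the outside part lies in `S′`.
  hereditarily-∪ : ∀ {S S′ : Pred (Fin n) 0ℓ} → (∀ {u v} → S u → H ⊢ u ~ v → S v) →
                   Hereditarily S → Hereditarily S′ → Hereditarily (λ v → S v ⊎ S′ v)
  hereditarily-∪ {S} {S′} closed onS onS′ {m} K K⊑H S∪S′ =
    monotone K ((K [ inside ]) ⊎ᴳ (K [ outside ])) K⊑sum
      (summable _ _
        (onS (K [ inside ]) (⊑-trans (induced (Unique.filter⁺ inside? (Unique.allFin⁺ m))) K⊑H)
          (λ i → proj₂ (∈-filter⁻ inside? {xs = allFin m} (∈-lookup {xs = inside} i))))
        (onS′ (K [ outside ]) (⊑-trans (induced (Unique.filter⁺ (¬? ∘ inside?) (Unique.allFin⁺ m))) K⊑H)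
          (λ i → [ (λ s → contradiction s (proj₂ (∈-filter⁻ (¬? ∘ inside?) {xs = allFin m}
                                                      (∈-lookup {xs = outside} i))))
                 , id ]′ (S∪S′ (lookup outside i)))))
    where
    open _⊑_ K⊑H

    inside? : Decidable (S ∘ embed)
    inside? _ = em

    inside outside : List (Fin m)
    inside  = filter inside? (allFin m)
    outside = filter (¬? ∘ inside?) (allFin m)

    induced : ∀ {xs} → Unique xs → (K [ xs ]) ⊑ K
    induced {xs} unique = record
      { embed = lookup xs ; injective = lookup-injective unique ; edges = λ _ _ → id }

    place : ∀ i → (S (embed i) × ∃[ a ] lookup inside a ≡ i) ⊎ (¬ S (embed i) × ∃[ b ] lookup outside b ≡ i)
    place i with inside? i
    ... | yes s = inj₁ (s , Any.index i∈ , sym (lookup-index i∈))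
      where i∈ = ∈-filter⁺ inside? (∈-allFin i) s
    ... | no ¬s = inj₂ (¬s , Any.index i∈ , sym (lookup-index i∈))
      where i∈ = ∈-filter⁺ (¬? ∘ inside?) (∈-allFin i) ¬s

    code : Fin m → Fin (length inside + length outside)
    code i with place i
    ... | inj₁ (_ , a , _) = a ↑ˡ length outside
    ... | inj₂ (_ , b , _) = length inside ↑ʳ b

    uncode : Fin (length inside + length outside) → Fin m
    uncode = [ lookup inside , lookup outside ]′ ∘ splitAt (length inside)

    uncode-code : ∀ i → uncode (code i) ≡ i
    uncode-code i with place i
    ... | inj₁ (_ , a , eq) rewrite splitAt-↑ˡ (length inside) a (length outside) = eq
    ... | inj₂ (_ , b , eq) rewrite splitAt-↑ʳ (length inside) (length outside) b = eq

    code-edge : ∀ i j → K ⊢ i ~ j → ((K [ inside ]) ⊎ᴳ (K [ outside ])) ⊢ code i ~ code j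
    code-edge i j e with place i | place j
    ... | inj₁ (s , _) | inj₂ (¬s , _) = contradiction (closed s (edges i j e)) ¬s
    ... | inj₂ (¬s , _) | inj₁ (s , _) = contradiction (closed s (edges j i (subst T (adj-sym K i j) e))) ¬s
    ... | inj₁ (_ , a , refl) | inj₁ (_ , b , refl)
      rewrite splitAt-↑ˡ (length inside) a (length outside)
            | splitAt-↑ˡ (length inside) b (length outside) = e
    ... | inj₂ (_ , a , refl) | inj₂ (_ , b , refl)
      rewrite splitAt-↑ʳ (length inside) (length outside) a
            | splitAt-↑ʳ (length inside) (length outside) b = e

    K⊑sum : K ⊑ ((K [ inside ]) ⊎ᴳ (K [ outside ]))
    K⊑sum = record
      { embed     = code
      ; injective = λ {i} {j} eq → trans (sym (uncode-code i)) (trans (cong uncode eq) (uncode-code j))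
      ; edges     = code-edge
      }

  -- The components of the listed vertices are added one at a time. Repeated components do no harm,
  -- since `hereditarily-∪` passes on only what lies outside the current one.
  componentwise : (v : Fin n) → (∀ v → Hereditarily (Joined H v)) → 𝒫 H
  componentwise v₀ components = reached (allFin n) H
    (record { embed = id ; injective = id ; edges = λ _ _ → id })
    (λ v → lose (∈-allFin v) done)
    where
    reached : ∀ vs → Hereditarily (λ u → Any (λ v → Joined H v u) vs)
    -- Here `K` has no vertices; it is in `𝒫` because it lies, vacuously, in the component of `v₀`.
    reached [] K K⊑H none = components v₀ K K⊑H λ i → contradiction (none i) λ ()
    reached (v ∷ vs) K K⊑H some =
      hereditarily-∪ {Joined H v} {λ u → Any (λ v → Joined H v u) vs} (λ p e → p ◅◅ (e ◅ done))
        (components v) (reached vs) K K⊑H (Any.toSum ∘ some)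

-- Cutting

xor⇒⊎ : ∀ a b → T (a xor b) → T a ⊎ T b
xor⇒⊎ true  _ _ = inj₁ _
xor⇒⊎ false _ b = inj₂ b

xor⇒¬∧ : ∀ a b → T (a xor b) → T a → ¬ T b
xor⇒¬∧ true b p _ = T-not p

≢⇒xor : ∀ {a b} → a ≢ b → T (a xor b)
≢⇒xor {true}  {true}  a≢b = contradiction refl a≢b
≢⇒xor {true}  {false} _   = _
≢⇒xor {false} {true}  _   = _
≢⇒xor {false} {false} a≢b = contradiction refl a≢b

xor-∧ : ∀ a {b} → T (a xor (a ∧ b)) → T a × T (not b)
xor-∧ true t = _ , t

-- The list that underlies #pairs.
pairs : ∀ n → List (Fin n × Fin n)
pairs n = filter (λ (u , v) → u <? v) (cartesianProduct (allFin n) (allFin n))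

crossing : Graph n → (Fin n → Bool) → Fin n × Fin n → Bool
crossing G w (u , v) = adj G u v ∧ (w u xor w v)

internal : Graph n → (Fin n → Bool) → Fin n × Fin n → Bool
internal G w (u , v) = adj G u v ∧ (w u ∧ w v)

module _ (G : Graph n) {k} (w : Fin k → Fin n → Bool) where

  uncut? : ∀ u v → Dec (∀ i → w i u ≡ w i v)
  uncut? u v = all? λ i → w i u Bool.≟ w i v

  -- G without the edges that cross the boundary of one of the sets w i.
  cut : Graph n
  cut = record
    { adj     = λ u v → adj G u v ∧ does (uncut? u v)
    ; adj-sym = λ u v → cong₂ _∧_ (adj-sym G u v)
                  (does-⇔ (mk⇔ (sym ∘_) (sym ∘_)) (uncut? u v) (uncut? v u))
    ; no-loop = λ v → cong (_∧ does (uncut? v v)) (no-loop G v)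
    }

  cut-edge : ∀ {u v} → cut ⊢ u ~ v → G ⊢ u ~ v × (∀ i → w i u ≡ w i v)
  cut-edge {u} {v} e with uv , eq ← Equivalence.to T-∧ e = uv , T-does (uncut? u v) eq

  cut-⊑ : cut ⊑ G
  cut-⊑ = record { embed = id ; injective = id ; edges = λ _ _ → proj₁ ∘ cut-edge }

  modified⇒crossing : ∀ u v → T (adj G u v xor adj cut u v) → ∃[ i ] T (crossing G (w i) (u , v))
  modified⇒crossing u v t
    with uv , ¬does ← xor-∧ (adj G u v) t
    with i , wu≢wv ← ¬∀⟶∃¬ k _ (λ i → w i u Bool.≟ w i v)
                       (λ eq → T-not ¬does (subst T (sym (dec-true (uncut? u v) eq)) _)) =
    i , Equivalence.from T-∧ (uv , ≢⇒xor wu≢wv)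

-- Only pairs with `u` before `v` are counted; an edge in the other order is carried over by
-- symmetry.
#modified-zero : ∀ (G H : Graph n) → #modified G H ≡ 0 → G ⊑ H
#modified-zero {n} G H eq = record { embed = id ; injective = id ; edges = edge }
  where
  unmodified : ∀ {a b} → ¬ T (a xor b) → T a → T b
  unmodified {true} {true}  _ _ = _
  unmodified {true} {false} p _ = p _

  ordered : ∀ {u v} → u Fin.< v → G ⊢ u ~ v → H ⊢ u ~ v
  ordered {u} {v} u<v = unmodified (count-zero {xs = pairs n} eq
    (∈-filter⁺ (λ (u , v) → u <? v) (∈-cartesianProduct⁺ (∈-allFin u) (∈-allFin v)) u<v))

  edge : ∀ u v → G ⊢ u ~ v → H ⊢ u ~ v
  edge u v e with <-cmp u v
  ... | tri< u<v _ _  = ordered u<v e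
  ... | tri≈ _ refl _ = contradiction e (subst (¬_ ∘ T) (sym (no-loop G u)) id)
  ... | tri> _ _ v<u  = subst T (adj-sym H v u) (ordered v<u (subst T (adj-sym G u v) e))

-- Layers around the colour classes.

module _ (G : Graph n) {k} (c : Fin n → Fin k) where

  within? : ∀ i j u → Dec (∃[ v ] c v ≡ i × dist≤ G j v u)
  within? i j u = any? λ v → c v ≟ i ×-dec dist≤? G j v u

  within : Fin k → ℕ → Fin n → Bool
  within i j u = ⌊ within? i j u ⌋

  within-step : ∀ i j {u v} → G ⊢ u ~ v → T (within i j u) → T (within i (suc j) u) × T (within i (suc j) v)
  within-step i j {u} {v} e t with x , eq , d ← toWitness {a? = within? i j u} t =
    fromWitness {a? = within? i (suc j) u} (x , eq , dist≤-mono G (n≤1+n j) d) ,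
    fromWitness {a? = within? i (suc j) v} (x , eq , dist≤-snoc G d e)

  -- An edge with one end within `j` of colour `i` has both ends within `suc j`. So the edges
  -- crossing layer `j` and those internal to it are disjoint sets of edges internal to layer
  -- `suc j`, and `small-increment` applies.
  small-boundary : ∀ m .{{_ : NonZero m}} i →
                   ∃[ j ] j < m × m * count (crossing G (within i j)) (pairs n) ≤ ∣E G ∣
  small-boundary m i = small-increment m
    (λ j → count (internal G (within i j)) (pairs n))
    (λ j → count (crossing G (within i j)) (pairs n))
    (λ j → count-disjoint (crossing⇒ j) (internal⇒ j) (exclusive j) (pairs n))
    -- With `g` constantly false, `count-disjoint` becomes monotonicity of `count`.
    (λ j → ≤-trans (m≤m+n _ _) (count-disjoint {g = λ _ → false}
      (λ (u , v) → proj₁ ∘ Equivalence.to T-∧) (λ _ ()) (λ _ _ ()) (pairs n)))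
    where
    flip-edge : ∀ {u v} → G ⊢ u ~ v → G ⊢ v ~ u
    flip-edge {u} {v} = subst T (adj-sym G u v)

    both : ∀ j {u v} → G ⊢ u ~ v → T (within i j u) → T (internal G (within i (suc j)) (u , v))
    both j {u} {v} e t = Equivalence.from T-∧ (e , Equivalence.from T-∧ (within-step i j e t))

    crossing⇒ : ∀ j p → T (crossing G (within i j) p) → T (internal G (within i (suc j)) p)
    crossing⇒ j (u , v) t with Equivalence.to T-∧ t
    ... | e , x with xor⇒⊎ (within i j u) (within i j v) x
    ...   | inj₁ wu = both j e wu
    ...   | inj₂ wv with a , b ← within-step i j (flip-edge e) wv =
      Equivalence.from T-∧ (e , Equivalence.from T-∧ (b , a))

    internal⇒ : ∀ j p → T (internal G (within i j) p) → T (internal G (within i (suc j)) p)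
    internal⇒ j (u , v) t with e , x ← Equivalence.to T-∧ t = both j e (proj₁ (Equivalence.to T-∧ x))

    exclusive : ∀ j p → T (crossing G (within i j) p) → ¬ T (internal G (within i j) p)
    exclusive j (u , v) t t′ with Equivalence.to (T-∧ {adj G u v}) t | Equivalence.to (T-∧ {adj G u v}) t′
    ... | _ , x | _ , y with wu , wv ← Equivalence.to (T-∧ {within i j u}) y =
      xor⇒¬∧ (within i j u) (within i j v) x wu wv

  -- Radii range below `k * l` so that each of the `k` boundaries has at most a `1/(k * l)` fraction
  -- of the edges, and their union at most `1/l`.
  small-cut : ∀ l .{{_ : NonZero k}} .{{_ : NonZero l}} →
              Σ (Fin k → ℕ) λ j → (∀ i → j i < k * l) ×
              l * #modified G (cut G (λ i → within i (j i))) ≤ ∣E G ∣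
  small-cut l = j , (λ i → proj₁ (proj₂ (boundary i))) , *-cancelˡ-≤ k (begin
    k * (l * #modified G H)  ≡⟨ *-assoc k l _ ⟨
    k * l * #modified G H    ≤⟨ count-union (λ i → crossing G (within i (j i)))
                                  {λ (u , v) → adj G u v xor adj H u v} (pairs n) {k * l}
                                  (λ i → proj₂ (proj₂ (boundary i)))
                                  (λ (u , v) → modified⇒crossing G (λ i → within i (j i)) u v) ⟩
    k * ∣E G ∣               ∎)
    where
    open ≤-Reasoning
    instance
      kl≢0 : NonZero (k * l)
      kl≢0 = m*n≢0 k l

    boundary = small-boundary (k * l)

    j : Fin k → ℕ
    j i = proj₁ (boundary i)

    H = cut G (λ i → within i (j i))

  -- A path in the cut graph stays within distance j i of colour i, and the
  -- scale r of the chains exceeds 2m.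
  chain-along-cut : ∀ {m} {j : Fin k → ℕ} → (∀ i → j i ≤ m) →
                    let H = cut G (λ i → within i (j i)) in
                    ∀ {v u} → Joined H v u → ∃[ x ] Chain G c (m + suc m) v x × dist≤ G m x u
  chain-along-cut {m} {j} j≤m {v} joined =
    along v start refl here (fromWitness {a? = within? (c v) (j (c v)) v} (v , refl , here)) joined
    where
    w = λ i → within i (j i)

    -- Invariant: `x` ends a chain, has the colour of `v` and is within `m` of the current vertex
    -- `y`, which lies in the layer of that colour. An uncut edge leads to a `y′` in the same layer,
    -- and this yields the next `x′`.
    along : ∀ x {y u} → Chain G c (m + suc m) v x → c x ≡ c v → dist≤ G m x y → T (w (c v) y) →
            Joined (cut G w) y u → ∃[ z ] Chain G c (m + suc m) v z × dist≤ G m z u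
    along x p eq d t done = x , p , d
    along x p eq d t (_◅_ {j = y′} e es)
      with G-edge , same ← cut-edge G w e
      with t′ ← subst T (same (c v)) t
      with x′ , eq′ , d′ ← toWitness {a? = within? (c v) (j (c v)) y′} t′
      with d″ ← dist≤-mono G (j≤m (c v)) d′ =
      -- From `x` to `y`, over the edge to `y′`, then to `x′`: at most `m + 1 + m`, exactly the
      -- scale of the chains.
      along x′ (extend p (trans eq (sym eq′)) (dist≤-trans G d (step G-edge (dist≤-sym G d″))))
        eq′ d″ t′ es

  -- From universal acceptance to a nearby graph in `𝒫`.

  module _ (em : ExcludedMiddle 0ℓ) (𝒫 : GraphClass) (monotone : Monotone 𝒫) (summable : Summable 𝒫) where

    -- A component of the cut graph stays within `D + m` of each of its vertices: `D` along the
    -- chain and `m` beyond it. This is inside the radius that `near-∈` covers.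
    accepted⇒cut-∈ : ∀ {D m} {j : Fin k → ℕ} → (∀ i → j i ≤ m) → Fin n →
                     (∀ v → Accept 𝒫 D (m + suc m) G c v) → 𝒫 (cut G (λ i → within i (j i)))
    accepted⇒cut-∈ {D} {m} {j} j≤m v₀ accepted = componentwise em 𝒫 monotone summable H v₀ components
      where
      H = cut G (λ i → within i (j i))

      components : ∀ v → Hereditarily em 𝒫 monotone summable H (Joined H v)
      components v K K⊑H joined = near-∈ (accepted v) K (⊑-trans K⊑H (cut-⊑ G (λ i → within i (j i)))) λ i →
        let x , p , d = chain-along-cut {m} {j} j≤m (joined i) in
        dist≤-mono G (+-monoʳ-≤ D (m≤m+n m (suc m))) (dist≤-trans G (chain-near (accepted v) p) d)

    accepted⇒close : ∀ {D l} .{{_ : NonZero k}} .{{_ : NonZero l}} → Fin n →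
                     (∀ v → Accept 𝒫 D (k * l + suc (k * l)) G c v) →
                     ∃[ H ] 𝒫 H × l * #modified G H ≤ ∣E G ∣
    accepted⇒close {D} {l} v₀ accepted = close (small-cut l)
      where
      close : (Σ (Fin k → ℕ) λ j → (∀ i → j i < k * l) ×
              l * #modified G (cut G (λ i → within i (j i))) ≤ ∣E G ∣) →
              ∃[ H ] 𝒫 H × l * #modified G H ≤ ∣E G ∣
      close (_ , j<m , few) = _ , accepted⇒cut-∈ {D} {k * l} (<⇒≤ ∘ j<m) v₀ accepted , few

-- The real number ε

-- `b` is the denominator of a positive rational `q` in the lower cut, which exists by roundedness.
-- The numerator is at least 1, so `q * m ≤ k` implies `m ≤ k * b`.
≤ℝ⇒≤ : ∀ {ε} → Positive ε → ∃[ b ] ∀ m k → ε · m ≤ℝ k → m ≤ k * b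
≤ℝ⇒≤ {ε} ε>0 with Equivalence.to (ℝ.lower-rounded ε 0ℚ) ε>0
... | mkℚ (+ zero)   b-1 _ , ℚ.*<* (+<+ ()) , _
... | mkℚ -[1+ _ ]   b-1 _ , ℚ.*<* () , _
... | q@(mkℚ (+ suc a) b-1 _) , _ , q<ε = suc b-1 , bound
  where
  bound : ∀ m k → ε · m ≤ℝ k → m ≤ k * suc b-1
  bound m k εm≤k = begin
    m                    ≤⟨ m≤m+n m (a * m) ⟩
    suc a * m            ≤⟨ drop‿+≤+ (subst₂ ℤ._≤_ lhs rhs (ℚᵘ.drop-*≤* unnormalised)) ⟩
    k * suc b-1          ∎
    where
    open ≤-Reasoning

    unnormalised : toℚᵘ q ℚᵘ.* mkℚᵘ (+ m) 0 ℚᵘ.≤ mkℚᵘ (+ k) 0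
    unnormalised = ℚᵘ.≤-respˡ-≃
      (ℚᵘ.≃-trans (ℚ.toℚᵘ-homo-* q (+ m ℚ./ 1)) (ℚᵘ.*-congˡ {toℚᵘ q} (ℚ.toℚᵘ-fromℚᵘ (mkℚᵘ (+ m) 0))))
      (ℚᵘ.≤-respʳ-≃ (ℚ.toℚᵘ-fromℚᵘ (mkℚᵘ (+ k) 0)) (ℚ.toℚᵘ-mono-≤ (εm≤k q q<ε)))

    lhs : (+ suc a ℤ.* + m) ℤ.* + 1 ≡ + (suc a * m)
    lhs = trans (ℤ.*-identityʳ _) (sym (ℤ.pos-* (suc a) m))

    rhs : + k ℤ.* (+ suc b-1 ℤ.* + 1) ≡ + (k * suc b-1)
    rhs = trans (cong (+ k ℤ.*_) (ℤ.*-identityʳ _)) (sym (ℤ.pos-* k (suc b-1)))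

-- Cutting with `suc b` instead of `b` makes the number `x` of modifications satisfy
-- `suc b * x ≤ ∣E G ∣ ≤ x * b`, hence `x` is zero. Then `G` is a subgraph of a graph in `𝒫`,
-- against farness.
accepted⇒¬far : ExcludedMiddle 0ℓ → (𝒫 : GraphClass) → Monotone 𝒫 → Summable 𝒫 →
                ∀ (G : Graph n) {k} .{{_ : NonZero k}} (c : Fin n → Fin k) {ε b D} →
                (∀ m k → ε · m ≤ℝ k → m ≤ k * b) → Fin n →
                (∀ v → Accept 𝒫 D (k * suc b + suc (k * suc b)) G c v) → ¬ Far ε 𝒫 G
accepted⇒¬far em 𝒫 monotone summable G c {b = b} {D} ε-bound v₀ accepted (G∉𝒫 , far) =
  G∉𝒫 (monotone G H (#modified-zero G H unmodified) H∈𝒫)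
  where
  open ≤-Reasoning

  close = accepted⇒close G c em 𝒫 monotone summable {D} {suc b} v₀ accepted
  H     = proj₁ close
  H∈𝒫   = proj₁ (proj₂ close)

  unmodified : #modified G H ≡ 0
  unmodified = n≤0⇒n≡0 (+-cancelʳ-≤ (b * #modified G H) (#modified G H) 0 (begin
    suc b * #modified G H  ≤⟨ proj₂ (proj₂ close) ⟩
    ∣E G ∣                 ≤⟨ ε-bound ∣E G ∣ (#modified G H) (far H H∈𝒫) ⟩
    #modified G H * b      ≡⟨ *-comm (#modified G H) b ⟩
    b * #modified G H      ∎))

proofSize≤ : ∀ {K} (P : Proof n) → (∀ v → length (P v) ≤ K) → proofSize P ≤ K
proofSize≤ {n} P small = max≤v⁺ {xs = map (length ∘ P) (allFin n)} z≤n
  (All.map⁺ (All.universal small (allFin n)))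

-- The scheme.

module _ (em : ExcludedMiddle 0ℓ) (p : Polynomial) (ε : ℝ)
         (b : ℕ) (ε-bound : ∀ m k → ε · m ≤ℝ k → m ≤ k * b)
         (𝒢 : GraphClass) (d : ℕ) (bounded : AsymptoticDimension≤ 𝒢 d)
         (𝒫 : GraphClass) (property : IsPropertyOf 𝒢 𝒫) (monotone : Monotone 𝒫) (summable : Summable 𝒫)
         where

  private
    -- `m` exceeds all layer radii for `suc d` colours. It and `r` depend only on `d` and `ε`, so
    -- `D` can be taken at scale `r` afterwards.
    m = suc d * suc b
    r = m + suc m
    D = proj₁ bounded r

    r≥1 : 1 ≤ r
    r≥1 = ≤-trans (s≤s z≤n) (m≤n+m (suc m) m)

    colours : (G : Instance p) → 𝒫 (underlying G) → Fin (size G) → Fin (suc d)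
    colours G G∈𝒫 = colouring 𝒢 bounded r≥1 (underlying G) (IsPropertyOf.included property _ G∈𝒫)

    decision : (G : Instance p) (P : Proof (size G)) → ∀ v → Dec (Accept 𝒫 D r (underlying G) (decode {d} ∘ P) v)
    decision G = accepts? em 𝒫 D r d (underlying G)

    all-accept : ∀ (G : Instance p) (G∈𝒫 : 𝒫 (underlying G)) v →
                 Accept 𝒫 D r (underlying G) (decode {d} ∘ encode ∘ colours G G∈𝒫) v
    all-accept G G∈𝒫 v =
      -- Transport along the identity of `G` exchanges the colouring for its decoded encoding, with
      -- which it agrees pointwise.
      accept-push 𝒫 D r id v id (λ _ _ → refl) (decode-encode ∘ colours G G∈𝒫) (λ _ → _ , refl)
        λ where
          .chain-near → chain-in-component 𝒢 bounded r≥1 (underlying G) (IsPropertyOf.included property _ G∈𝒫)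
          .near-∈ K K⊑G _ → monotone K _ K⊑G G∈𝒫

    some-reject : ∀ (G : Instance p) → Far ε 𝒫 (underlying G) → ∀ P →
                  ∃[ v ] ¬ Accept 𝒫 D r (underlying G) (decode {d} ∘ P) v
    some-reject G far P = ¬∀⟶∃¬ (size G) _ (decision G P) λ accepted →
      accepted⇒¬far em 𝒫 monotone summable (underlying G) (decode {d} ∘ P)
        -- Connectedness includes having a vertex; it serves as `v₀` in `componentwise`.
        {ε} {b} {D} ε-bound (fromℕ< (proj₁ (connected G))) accepted far

  scheme : ApproximateProofLabellingScheme p (D + r) ε 𝒫
  scheme .prover G G∈𝒫 = encode ∘ colours G G∈𝒫
  scheme .verifier = colourVerifier em 𝒫 D r d
  scheme .local = colourVerifier-local em 𝒫 D r d
  scheme .completeness G G∈𝒫 v = dec-true (decision G _ v) (all-accept G G∈𝒫 v)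
  scheme .soundness G far P = map₂ (λ {v} → dec-false (decision G P v)) (some-reject G far P)

  scheme-complexity : Complexity≤ scheme d
  scheme-complexity G G∈𝒫 = proofSize≤ (encode ∘ colours G G∈𝒫) (encode-length ∘ colours G G∈𝒫)

theorem5 : ExcludedMiddle 0ℓ →
    (p : Polynomial) (ε : ℝ) → Positive ε →
    (𝒢 : GraphClass) → BoundedAsymptoticDimension 𝒢 →
    (𝒫 : GraphClass) → IsPropertyOf 𝒢 𝒫 → Monotone 𝒫 → Summable 𝒫 →
    ∃[ r ] ∃[ K ] Σ (ApproximateProofLabellingScheme p r ε 𝒫) (λ S → Complexity≤ S K)
theorem5 em p ε ε>0 𝒢 (d , bounded) 𝒫 property monotone summable =
  let b , ε-bound = ≤ℝ⇒≤ {ε} ε>0 in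
  _ , d , scheme em p ε b ε-bound 𝒢 d bounded 𝒫 property monotone summable
        , scheme-complexity em p ε b ε-bound 𝒢 d bounded 𝒫 property monotone summable
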